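{- Let $A$ be a finite set of alternatives and let $\mathcal D\subseteq\mathcal L(A)$ be a Condorcet domain. Then $\mathcal D$ is a peak-pit maximal Condorcet domain if and only if $\mathcal D$ is a maximal peak-pit Condorcet domain.
   Context: $\mathcal L(A)$ is the set of linear orders on the finite set $A$; a linear order is written as a word listing alternatives from top to bottom. For $B\subseteq A$ and a domain $\mathcal D\subseteq\mathcal L(A)$, $\mathcal D_B=\{R_B:R\in\mathcal D\}$ where $R_B$ is the restriction of $R$ to $B$. For distinct $a,b,c$, $x\in\{a,b,c\}$, $k\in\{1,2,3\}$, $\mathcal D_{\{a,b,c\}}$ satisfies the never-condition $xN_{\{a,b,c\}}k$ if no $x_1x_2x_3\in\mathcal D_{\{a,b,c\}}$ has $x_k=x$ ($k=1$ never-top, $k=3$ never-bottom, $k=2$ never-middle). $\mathcal D$ is a Condorcet domain if for every triple of distinct alternatives $\mathcal D_{\{a,b,c\}}$ satisfies some never-condition, and a peak-pit Condorcet domain if for every triple it satisfies some never-top or never-bottom condition. A peak-pit Condorcet domain $\mathcal D$ is a peak-pit maximal Condorcet domain if every Condorcet domain $\mathcal D'\subseteq\mathcal L(A)$ with $\mathcal D\subseteq\mathcal D'$ equals $\mathcal D$; it is a maximal peak-pit Condorcet domain if every peak-pit Condorcet domain $\mathcal D'\subseteq\mathcal L(A)$ with $\mathcal D\subseteq\mathcal D'$ equals $\mathcal D$. -}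

module Defs where

open import Data.Nat using (ℕ; zero; suc)
open import Data.Fin using (Fin; _≟_)
open import Data.Maybe using (Maybe; just; nothing)
open import Data.List using (List; []; _∷_; filter)
open import Data.List.Membership.Propositional using (_∈_)
open import Data.List.Relation.Unary.Unique.Propositional using (Unique)
open import Data.Product using (_×_; Σ)
open import Data.Sum using (_⊎_)
open import Relation.Nullary using (¬_)
open import Relation.Nullary.Decidable using (_⊎-dec_)
open import Relation.Binary.PropositionalEquality using (_≡_)

-- The finite set of alternatives A is Fin n.
-- A linear order on A is a word listing every alternative exactly once (top first).
IsLinearOrder : {n : ℕ} → List (Fin n) → Set
IsLinearOrder {n} w = Unique w × (∀ (x : Fin n) → x ∈ w)

-- A domain is a finite set of words (represented by a list; duplicates/order irrelevant).
Domain : ℕ → Set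
Domain n = List (List (Fin n))

IsDomain : {n : ℕ} → Domain n → Set
IsDomain D = ∀ w → w ∈ D → IsLinearOrder w

_⊆D_ : {n : ℕ} → Domain n → Domain n → Set
D ⊆D D' = ∀ w → w ∈ D → w ∈ D'

restrict3 : {n : ℕ} → Fin n → Fin n → Fin n → List (Fin n) → List (Fin n)
restrict3 a b c = filter (λ y → (y ≟ a) ⊎-dec ((y ≟ b) ⊎-dec (y ≟ c)))

at : {A : Set} → List A → ℕ → Maybe A
at [] _ = nothing
at (y ∷ ys) zero = just y
at (y ∷ ys) (suc k) = at ys k

-- position k ∈ {1,2,3} of the paper is represented by Fin 3 (0 = top, 1 = middle, 2 = bottom)
pos : Fin 3 → ℕ
pos k = Data.Fin.toℕ k

Never : {n : ℕ} → Domain n → Fin n → Fin n → Fin n → Fin n → Fin 3 → Set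
Never D a b c x k = ∀ w → w ∈ D → ¬ (at (restrict3 a b c w) (pos k) ≡ just x)

Distinct3 : {n : ℕ} → Fin n → Fin n → Fin n → Set
Distinct3 a b c = ¬ (a ≡ b) × ¬ (a ≡ c) × ¬ (b ≡ c)

In3 : {n : ℕ} → Fin n → Fin n → Fin n → Fin n → Set
In3 x a b c = x ≡ a ⊎ x ≡ b ⊎ x ≡ c

TopOrBottom : Fin 3 → Set
TopOrBottom k = pos k ≡ 0 ⊎ pos k ≡ 2

IsCondorcet : {n : ℕ} → Domain n → Set
IsCondorcet {n} D = ∀ (a b c : Fin n) → Distinct3 a b c →
  Σ (Fin n) λ x → Σ (Fin 3) λ k → In3 x a b c × Never D a b c x k

IsPeakPitCondorcet : {n : ℕ} → Domain n → Set
IsPeakPitCondorcet {n} D = ∀ (a b c : Fin n) → Distinct3 a b c →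
  Σ (Fin n) λ x → Σ (Fin 3) λ k → In3 x a b c × TopOrBottom k × Never D a b c x k

IsPeakPitMaximalCD : {n : ℕ} → Domain n → Set
IsPeakPitMaximalCD {n} D = IsDomain D × IsPeakPitCondorcet D ×
  (∀ (D' : Domain n) → IsDomain D' → IsCondorcet D' → D ⊆D D' → D' ⊆D D)

IsMaximalPeakPitCD : {n : ℕ} → Domain n → Set
IsMaximalPeakPitCD {n} D = IsDomain D × IsPeakPitCondorcet D ×
  (∀ (D' : Domain n) → IsDomain D' → IsPeakPitCondorcet D' → D ⊆D D' → D' ⊆D D)

{-# OPTIONS --safe #-}
module Submission where

-- Let D be a maximal peak-pit domain. The pairwise majority order of three members of D is
-- linear and violates no never-condition of D, so D is closed under such medians. Suppose b is
-- never in the middle of {a, b, c}, and that b is on top in some r ∈ D and at the bottom in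
-- some s ∈ D; choose r and s with the fewest inversions. Then no other member of D lies between
-- them, and taking medians with r and s shows that every t ∈ D agrees with r, or with s, on all
-- pairs that r and s order differently. It follows that swapping an adjacent pair of r that is
-- inverted in s preserves the peak-pit property, so the result belongs to D and lies strictly
-- between r and s: a contradiction. Hence on a triple where b is never in the middle, b is
-- always on top in D or always at the bottom, and adding one more word without b in the middle
-- keeps the triple peak-pit. So every word of a Condorcet domain containing D already lies in D.

open import Defs
open import Data.Nat using (ℕ)
import Data.Nat as ℕ
import Data.Nat.Properties as ℕₚ
open import Data.Nat.Induction using (<-wellFounded)
open import Data.Fin using (Fin; zero; suc; _≟_)
open import Data.Maybe using (just)
open import Data.Maybe.Properties using (just-injective)
open import Data.List using (List; []; _∷_; _++_; filter; length; allFin; cartesianProduct)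
open import Data.List.Properties using (filter-accept; filter-reject)
open import Data.List.Membership.Propositional using (_∈_)
open import Data.List.Membership.Propositional.Properties using (∈-allFin; ∈-cartesianProduct⁺)
open import Data.List.Relation.Unary.Any using (here; there)
import Data.List.Relation.Unary.All as All
open import Data.List.Relation.Unary.AllPairs using (AllPairs; []; _∷_)
open import Data.List.Relation.Unary.Unique.Propositional using (Unique)
open import Data.List.Relation.Unary.Unique.Propositional.Properties using (allFin⁺)
open import Data.List.Relation.Unary.Sorted.TotalOrder.Properties using (Sorted⇒AllPairs)
open import Data.List.Relation.Binary.Sublist.Propositional
  using (_⊆_; []; _∷_; _∷ʳ_; from∈; lookup)
open import Data.List.Relation.Binary.Permutation.Propositional
  using (_↭_; ↭-refl; ↭-sym; ↭⇒↭ₛ) renaming (swap to ↭-swap)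
open import Data.List.Relation.Binary.Permutation.Propositional.Properties using (∈-resp-↭; ++⁺ˡ)
open import Data.List.Relation.Binary.Permutation.Setoid.Properties using (Unique-resp-↭)
import Data.List.Sort as Sort
open import Data.Product using (_×_; ∃-syntax; _,_; proj₁; proj₂)
open import Data.Sum using (_⊎_; inj₁; inj₂; [_,_]′) renaming (map to ⊎-map; swap to ⊎-swap)
open import Data.Empty using (⊥-elim)
open import Function using (_∘_; case_of_)
open import Function.Bundles using (_⇔_; mk⇔)
open import Induction.WellFounded using (Acc; acc)
open import Level using (0ℓ)
open import Relation.Nullary using (¬_; Dec; yes; no)
open import Relation.Nullary.Decidable using (_×-dec_; _⊎-dec_)
open import Relation.Unary using (Pred; Decidable)
open import Relation.Binary.Bundles using (DecTotalOrder)
open import Relation.Binary.PropositionalEquality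
  using (_≡_; _≢_; refl; sym; trans; cong; setoid; isEquivalence)

private variable
  A : Set
  n : ℕ

-- Precedence in a word.

data _≺[_]_ {A : Set} : A → List A → A → Set where
  here  : ∀ {x y w} → y ∈ w → x ≺[ x ∷ w ] y
  there : ∀ {x y z w} → x ≺[ w ] y → x ≺[ z ∷ w ] y

≺⇒∈ʳ : ∀ {x y : A} {w} → x ≺[ w ] y → y ∈ w
≺⇒∈ʳ (here p)  = there p
≺⇒∈ʳ (there p) = there (≺⇒∈ʳ p)

≺-irrefl : ∀ {x : A} {w} → Unique w → ¬ x ≺[ w ] x
≺-irrefl (x∉ ∷ _) (here p)  = All.lookup x∉ p refl
≺-irrefl (_ ∷ u)  (there p) = ≺-irrefl u p

≺-trans : ∀ {x y z : A} {w} → Unique w → x ≺[ w ] y → y ≺[ w ] z → x ≺[ w ] z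
≺-trans (x∉ ∷ _) (here p)  (here q)  = here q
≺-trans (x∉ ∷ _) (here p)  (there q) = here (≺⇒∈ʳ q)
≺-trans (x∉ ∷ _) (there p) (here q)  = ⊥-elim (All.lookup x∉ (≺⇒∈ʳ p) refl)
≺-trans (_ ∷ u)  (there p) (there q) = there (≺-trans u p q)

≺-total : ∀ {x y : A} {w} → x ≢ y → x ∈ w → y ∈ w → x ≺[ w ] y ⊎ y ≺[ w ] x
≺-total x≢y (here refl) (here refl) = ⊥-elim (x≢y refl)
≺-total x≢y (here refl) (there q)   = inj₁ (here q)
≺-total x≢y (there p)   (here refl) = inj₂ (here p)
≺-total x≢y (there p)   (there q)   = ⊎-map there there (≺-total x≢y p q)

≺-sublist : ∀ {x y z : A} {w} → Unique w → x ≺[ w ] y → y ≺[ w ] z → (x ∷ y ∷ z ∷ []) ⊆ w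
≺-sublist _        (here p)  (there q) = refl ∷ pair q
  where
  pair : ∀ {x y : A} {w} → x ≺[ w ] y → (x ∷ y ∷ []) ⊆ w
  pair (here p)  = refl ∷ from∈ p
  pair (there p) = _ ∷ʳ pair p
≺-sublist (x∉ ∷ _) (here p)  (here q)  = ⊥-elim (All.lookup x∉ p refl)
≺-sublist (x∉ ∷ _) (there p) (here q)  = ⊥-elim (All.lookup x∉ (≺⇒∈ʳ p) refl)
≺-sublist (_ ∷ u)  (there p) (there q) = _ ∷ʳ ≺-sublist u p q

-- In a repetition-free `w` each letter of `xs` occurs only where the sublist places it, so
-- filtering keeps exactly these copies in the order of `xs`.
filter-sublist : {P : Pred A 0ℓ} (P? : Decidable P) {xs w : List A} → Unique w → xs ⊆ w →
  (∀ {y} → y ∈ xs → P y) → (∀ {y} → P y → y ∈ xs) → filter P? w ≡ xs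
filter-sublist {P = P} P? u τ sound complete = go u τ sound (λ _ → complete)
  where
  -- Completeness is asked only of letters of `w`: a consumed head still satisfies `P` though it has
  -- left `xs`, but by uniqueness it has also left `w`.
  go : ∀ {xs w} → Unique w → xs ⊆ w → (∀ {y} → y ∈ xs → P y) →
       (∀ {y} → y ∈ w → P y → y ∈ xs) → filter P? w ≡ xs
  go _ [] _ _ = refl
  go (y∉ ∷ u) (y ∷ʳ τ) s c = trans
    (filter-reject P? (λ Py → All.lookup y∉ (lookup τ (c (here refl) Py)) refl))
    (go u τ s (c ∘ there))
  go {x ∷ xs} (y∉ ∷ u) (refl ∷ τ) s c = trans (filter-accept P? (s (here refl)))
    (cong (x ∷_) (go u τ (s ∘ there) c′))
    where
    c′ : ∀ {y} → y ∈ _ → P y → y ∈ xs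
    c′ p Py with c (there p) Py
    ... | here refl = ⊥-elim (All.lookup y∉ p refl)
    ... | there q   = q

≺-asym : ∀ {x y : A} {w} → Unique w → x ≺[ w ] y → ¬ y ≺[ w ] x
≺-asym u p q = ≺-irrefl u (≺-trans u p q)

≺-connex : ∀ {w} → IsLinearOrder {n} w → ∀ {x y} → x ≢ y → x ≺[ w ] y ⊎ y ≺[ w ] x
≺-connex (_ , all) x≢y = ≺-total x≢y (all _) (all _)

≺-≢ : ∀ {x y : A} {w} → Unique w → x ≺[ w ] y → x ≢ y
≺-≢ u p refl = ≺-irrefl u p

≺-dec : ∀ {w} → IsLinearOrder {n} w → ∀ x y → Dec (x ≺[ w ] y)
≺-dec {w = w} lin x y with x ≟ y
... | yes refl = no (≺-irrefl (proj₁ lin))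
... | no x≢y with ≺-connex lin x≢y
...   | inj₁ p = yes p
...   | inj₂ p = no (≺-asym (proj₁ lin) p)

-- Adjacent swaps, sorting and counting.

linear-resp-↭ : ∀ {v w} → v ↭ w → IsLinearOrder {n} v → IsLinearOrder w
linear-resp-↭ v↭w (u , all) =
  Unique-resp-↭ (setoid _) (↭⇒↭ₛ v↭w) u , λ x → ∈-resp-↭ v↭w (all x)

swap-≺ : ∀ {x y p q : A} xs {ys} → x ≺[ xs ++ q ∷ p ∷ ys ] y →
  x ≺[ xs ++ p ∷ q ∷ ys ] y ⊎ (x ≡ q × y ≡ p)
swap-≺ []       (here (here refl))   = inj₂ (refl , refl)
swap-≺ []       (here (there r))     = inj₁ (there (here r))
swap-≺ []       (there (here r))     = inj₁ (here (there r))
swap-≺ []       (there (there r))    = inj₁ (there (there r))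
swap-≺ (_ ∷ xs) (here r)  = inj₁ (here (∈-resp-↭ (++⁺ˡ xs (↭-swap _ _ ↭-refl)) r))
swap-≺ (_ ∷ xs) (there r) = ⊎-map there (λ e → e) (swap-≺ xs r)

swapped-≺ : ∀ {p q : A} xs {ys} → q ≺[ xs ++ q ∷ p ∷ ys ] p
swapped-≺ []       = here (here refl)
swapped-≺ (_ ∷ xs) = there (swapped-≺ xs)

-- If `s` keeps the order of every adjacent pair of `r`, transitivity along `r` makes it keep all
-- pairs. Of `r` only uniqueness is assumed, so that the induction can pass to tails.
adjacent-inversion : ∀ {s} → IsLinearOrder {n} s → ∀ r → Unique r →
  (∃[ xs ] ∃[ p ] ∃[ q ] ∃[ ys ] (r ≡ xs ++ p ∷ q ∷ ys × q ≺[ s ] p))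
  ⊎ (∀ {x y} → x ≺[ r ] y → x ≺[ s ] y)
adjacent-inversion lin []      _ = inj₂ λ ()
adjacent-inversion lin (x ∷ []) _ = inj₂ λ where
  (here ())
  (there ())
adjacent-inversion {s = s} lin (x ∷ y ∷ r) ((x≢y All.∷ _) ∷ u)
  with ≺-connex lin x≢y | adjacent-inversion lin (y ∷ r) u
... | inj₂ y≺x | _ = inj₁ ([] , x , y , r , refl , y≺x)
... | inj₁ _   | inj₁ (xs , p , q , ys , e , q≺p) = inj₁ (x ∷ xs , p , q , ys , cong (x ∷_) e , q≺p)
... | inj₁ x≺y | inj₂ r⊆s = inj₂ λ where
  (here (here refl)) → x≺y
  (here (there m))   → ≺-trans (proj₁ lin) x≺y (r⊆s (here m))
  (there m)          → r⊆s m

-- Sort all alternatives by the reflexive closure of `M`: every earlier letter is then below every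
-- later one, and irreflexivity of precedence rules out the case of equality.
linearise : {M : Fin n → Fin n → Set} → (∀ x y → Dec (M x y)) →
  (∀ {x y} → x ≢ y → M x y ⊎ M y x) → (∀ {x y} → M x y → ¬ M y x) →
  (∀ {x y z} → M x y → M y z → M x z) →
  ∃[ w ] (IsLinearOrder {n} w × (∀ {x y} → x ≺[ w ] y → M x y))
linearise {n} {M} M? connex asym M-trans =
  w , lin , λ x≺y → [ (λ { refl → ⊥-elim (≺-irrefl (proj₁ lin) x≺y) }) , (λ m → m) ]′
    (allPairs⇒≺ (Sorted⇒AllPairs totalOrder (sort-↗ (allFin n))) x≺y)
  where
  _≼_ : Fin n → Fin n → Set
  x ≼ y = x ≡ y ⊎ M x y

  ≼-trans : ∀ {x y z} → x ≼ y → y ≼ z → x ≼ z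
  ≼-trans (inj₁ refl) q           = q
  ≼-trans (inj₂ p)    (inj₁ refl) = inj₂ p
  ≼-trans (inj₂ p)    (inj₂ q)    = inj₂ (M-trans p q)

  ≼-antisym : ∀ {x y} → x ≼ y → y ≼ x → x ≡ y
  ≼-antisym (inj₁ e) _        = e
  ≼-antisym (inj₂ _) (inj₁ e) = sym e
  ≼-antisym (inj₂ p) (inj₂ q) = ⊥-elim (asym p q)

  ≼-total : ∀ x y → x ≼ y ⊎ y ≼ x
  ≼-total x y with x ≟ y
  ... | yes e = inj₁ (inj₁ e)
  ... | no x≢y = ⊎-map inj₂ inj₂ (connex x≢y)

  order : DecTotalOrder 0ℓ 0ℓ 0ℓ
  order = record
    { Carrier = Fin n ; _≈_ = _≡_ ; _≤_ = _≼_
    ; isDecTotalOrder = record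
      { isTotalOrder = record
        { isPartialOrder = record
          { isPreorder = record
            { isEquivalence = isEquivalence ; reflexive = inj₁ ; trans = ≼-trans }
          ; antisym = ≼-antisym }
        ; total = ≼-total }
      ; _≟_ = _≟_
      ; _≤?_ = λ x y → (x ≟ y) ⊎-dec M? x y } }

  open DecTotalOrder order using (totalOrder)
  open Sort order

  w = sort (allFin n)

  lin : IsLinearOrder w
  lin = linear-resp-↭ (↭-sym (sort-↭ (allFin n))) (allFin⁺ n , ∈-allFin)

  allPairs⇒≺ : ∀ {R : Fin n → Fin n → Set} {v x y} → AllPairs R v → x ≺[ v ] y → R x y
  allPairs⇒≺ (h ∷ _) (here p)  = All.lookup h p
  allPairs⇒≺ (_ ∷ t) (there p) = allPairs⇒≺ t p

length-filter-⊂ : {P Q : Pred A 0ℓ} (P? : Decidable P) (Q? : Decidable Q) →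
  (∀ {x} → P x → Q x) → ∀ {x} xs → x ∈ xs → Q x → ¬ P x →
  length (filter P? xs) ℕ.< length (filter Q? xs)
length-filter-⊂ {P = P} {Q} P? Q? P⊆Q = go
  where
  mono : ∀ xs → length (filter P? xs) ℕ.≤ length (filter Q? xs)
  mono [] = ℕ.z≤n
  mono (x ∷ xs) with P? x | Q? x
  ... | yes _ | yes _ = ℕ.s≤s (mono xs)
  ... | yes p | no ¬q = ⊥-elim (¬q (P⊆Q p))
  ... | no _  | yes _ = ℕₚ.m≤n⇒m≤1+n (mono xs)
  ... | no _  | no _  = mono xs
  go : ∀ {x} xs → x ∈ xs → Q x → ¬ P x → length (filter P? xs) ℕ.< length (filter Q? xs)
  go (x ∷ xs) (here refl) q ¬p with P? x | Q? x
  ... | yes p | _     = ⊥-elim (¬p p)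
  ... | no _  | no ¬q = ⊥-elim (¬q q)
  ... | no _  | yes _ = ℕ.s≤s (mono xs)
  go (x ∷ xs) (there i) q ¬p with P? x | Q? x
  ... | yes _ | yes _ = ℕ.s≤s (go xs i q ¬p)
  ... | yes p | no ¬q = ⊥-elim (¬q (P⊆Q p))
  ... | no _  | yes _ = ℕₚ.m≤n⇒m≤1+n (go xs i q ¬p)
  ... | no _  | no _  = go xs i q ¬p

-- Triples, and never-conditions in terms of precedence.

-- A relabelling of the triple as a set. A never-condition singles out one alternative; this lets it
-- be listed first without treating the six orderings of `a`, `b`, `c` one by one.
record Arrangement {n : ℕ} (a b c x y z : Fin n) : Set where
  constructor arrangement
  field
    distinct : Distinct3 x y z
    ⊆abc     : ∀ {u} → In3 u x y z → In3 u a b c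
    abc⊆     : ∀ {u} → In3 u a b c → In3 u x y z

  x≢y = proj₁ distinct
  x≢z = proj₁ (proj₂ distinct)
  y≢z = proj₂ (proj₂ distinct)

open Arrangement

In3-swap : ∀ {u x y z : Fin n} → In3 u x y z → In3 u y x z
In3-swap (inj₁ e)        = inj₂ (inj₁ e)
In3-swap (inj₂ (inj₁ e)) = inj₁ e
In3-swap (inj₂ (inj₂ e)) = inj₂ (inj₂ e)

In3-rotate : ∀ {u x y z : Fin n} → In3 u x y z → In3 u y z x
In3-rotate (inj₁ e)        = inj₂ (inj₂ e)
In3-rotate (inj₂ (inj₁ e)) = inj₁ e
In3-rotate (inj₂ (inj₂ e)) = inj₂ (inj₁ e)

module _ {a b c : Fin n} where
  arr-swap : ∀ {x y z} → Arrangement a b c x y z → Arrangement a b c y x z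
  arr-swap r = arrangement (x≢y r ∘ sym , y≢z r , x≢z r) (⊆abc r ∘ In3-swap) (In3-swap ∘ abc⊆ r)

  arr-rotate : ∀ {x y z} → Arrangement a b c x y z → Arrangement a b c y z x
  arr-rotate r = arrangement (y≢z r , x≢y r ∘ sym , x≢z r ∘ sym)
    (⊆abc r ∘ In3-rotate ∘ In3-rotate) (In3-rotate ∘ abc⊆ r)

  arr-swapʳ : ∀ {x y z} → Arrangement a b c x y z → Arrangement a b c x z y
  arr-swapʳ = arr-rotate ∘ arr-swap

  arr-focus : Distinct3 a b c → ∀ {x} → In3 x a b c → ∃[ y ] ∃[ z ] Arrangement a b c x y z
  arr-focus d (inj₁ refl)        = _ , _ , arrangement d (λ i → i) (λ i → i)
  arr-focus d (inj₂ (inj₁ refl)) = _ , _ , arr-rotate (arrangement d (λ i → i) (λ i → i))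
  arr-focus d (inj₂ (inj₂ refl)) = _ , _ , arr-rotate (arr-rotate (arrangement d (λ i → i) (λ i → i)))

Top Bottom : List A → A → A → A → Set
Top    w x y z = x ≺[ w ] y × x ≺[ w ] z
Bottom w x y z = y ≺[ w ] x × z ≺[ w ] x

module _ {a b c : Fin n} {w : List (Fin n)} (lin : IsLinearOrder w) where
  restrict3-sorted : ∀ {x y z} → Arrangement a b c x y z → x ≺[ w ] y → y ≺[ w ] z →
    restrict3 a b c w ≡ x ∷ y ∷ z ∷ []
  restrict3-sorted r x≺y y≺z =
    filter-sublist _ (proj₁ lin) (≺-sublist (proj₁ lin) x≺y y≺z) (⊆abc r ∘ to) (from ∘ abc⊆ r)
    where
    to : ∀ {u x y z} → u ∈ x ∷ y ∷ z ∷ [] → In3 u x y z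
    to (here e)                  = inj₁ e
    to (there (here e))          = inj₂ (inj₁ e)
    to (there (there (here e)))  = inj₂ (inj₂ e)
    from : ∀ {u x y z} → In3 u x y z → u ∈ x ∷ y ∷ z ∷ []
    from (inj₁ e)        = here e
    from (inj₂ (inj₁ e)) = there (here e)
    from (inj₂ (inj₂ e)) = there (there (here e))

  at-top : ∀ {x y z} → Arrangement a b c x y z → Top w x y z → at (restrict3 a b c w) 0 ≡ just x
  at-top r (x≺y , x≺z) with ≺-connex lin (y≢z r)
  ... | inj₁ y≺z = cong (λ v → at v 0) (restrict3-sorted r x≺y y≺z)
  ... | inj₂ z≺y = cong (λ v → at v 0) (restrict3-sorted (arr-swapʳ r) x≺z z≺y)

  at-middle : ∀ {x y z} → Arrangement a b c x y z → y ≺[ w ] x → x ≺[ w ] z →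
    at (restrict3 a b c w) 1 ≡ just x
  at-middle r y≺x x≺z = cong (λ v → at v 1) (restrict3-sorted (arr-swap r) y≺x x≺z)

  at-bottom : ∀ {x y z} → Arrangement a b c x y z → Bottom w x y z →
    at (restrict3 a b c w) 2 ≡ just x
  at-bottom r (y≺x , z≺x) with ≺-connex lin (y≢z r)
  ... | inj₁ y≺z = cong (λ v → at v 2) (restrict3-sorted (arr-rotate r) y≺z z≺x)
  ... | inj₂ z≺y = cong (λ v → at v 2) (restrict3-sorted (arr-rotate (arr-swapʳ r)) z≺y y≺x)

  top-cases : ∀ {x y z} → Distinct3 x y z →
    Top w x y z ⊎ (Top w y x z ⊎ Top w z x y)
  top-cases (x≢y , x≢z , y≢z) with ≺-connex lin x≢y | ≺-connex lin x≢z | ≺-connex lin y≢z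
  ... | inj₁ p | inj₁ q | _      = inj₁ (p , q)
  ... | inj₁ p | inj₂ q | _      = inj₂ (inj₂ (q , ≺-trans (proj₁ lin) q p))
  ... | inj₂ p | _      | inj₁ s = inj₂ (inj₁ (p , s))
  ... | inj₂ p | _      | inj₂ s = inj₂ (inj₂ (≺-trans (proj₁ lin) s p , s))

  bottom-cases : ∀ {x y z} → Distinct3 x y z →
    Bottom w x y z ⊎ (Bottom w y x z ⊎ Bottom w z x y)
  bottom-cases (x≢y , x≢z , y≢z) with ≺-connex lin x≢y | ≺-connex lin x≢z | ≺-connex lin y≢z
  ... | inj₂ p | inj₂ q | _      = inj₁ (p , q)
  ... | inj₂ p | inj₁ q | _      = inj₂ (inj₂ (q , ≺-trans (proj₁ lin) p q))
  ... | inj₁ p | _      | inj₂ s = inj₂ (inj₁ (p , s))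
  ... | inj₁ p | _      | inj₁ s = inj₂ (inj₂ (≺-trans (proj₁ lin) p s , s))

  -- One of the three letters is on top of `w`; were it not `x`, then `at-top` would put a different
  -- letter at position 0.
  top-at : ∀ {x y z} → Arrangement a b c x y z → at (restrict3 a b c w) 0 ≡ just x → Top w x y z
  top-at r e with top-cases (distinct r)
  ... | inj₁ t        = t
  ... | inj₂ (inj₁ t) = ⊥-elim (x≢y r (just-injective (trans (sym e) (at-top (arr-swap r) t))))
  ... | inj₂ (inj₂ t) =
    ⊥-elim (x≢z r (just-injective (trans (sym e) (at-top (arr-rotate (arr-rotate r)) t))))

  bottom-at : ∀ {x y z} → Arrangement a b c x y z → at (restrict3 a b c w) 2 ≡ just x →
    Bottom w x y z
  bottom-at r e with bottom-cases (distinct r)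
  ... | inj₁ t        = t
  ... | inj₂ (inj₁ t) = ⊥-elim (x≢y r (just-injective (trans (sym e) (at-bottom (arr-swap r) t))))
  ... | inj₂ (inj₂ t) =
    ⊥-elim (x≢z r (just-injective (trans (sym e) (at-bottom (arr-rotate (arr-rotate r)) t))))

-- `NeverMiddle` is put positively, so that each member can be sorted by the end at which `x`
-- stands.
NeverTop NeverBottom NeverMiddle PeakPit : Domain n → Fin n → Fin n → Fin n → Set
NeverTop    D x y z = ∀ w → w ∈ D → ¬ Top w x y z
NeverBottom D x y z = ∀ w → w ∈ D → ¬ Bottom w x y z
NeverMiddle D x y z = ∀ w → w ∈ D → Top w x y z ⊎ Bottom w x y z
PeakPit D a b c = ∃[ x ] ∃[ y ] ∃[ z ]
  (Arrangement a b c x y z × (NeverTop D x y z ⊎ NeverBottom D x y z))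

module _ {D : Domain n} (dom : IsDomain D) where
  condorcet⇒ : IsCondorcet D → ∀ {a b c} → Distinct3 a b c →
    PeakPit D a b c ⊎ ∃[ x ] ∃[ y ] ∃[ z ] (Arrangement a b c x y z × NeverMiddle D x y z)
  condorcet⇒ C d with C _ _ _ d
  ... | x , k , x∈ , never with arr-focus d x∈
  ...   | y , z , r = go k never
    where
    go : ∀ k → Never D _ _ _ x k → _
    go zero never = inj₁ (x , y , z , r , inj₁ λ w m t → never w m (at-top (dom w m) r t))
    go (suc (suc zero)) never =
      inj₁ (x , y , z , r , inj₂ λ w m t → never w m (at-bottom (dom w m) r t))
    go (suc zero) never = inj₂ (x , y , z , r , λ w m → mid w m)
      where
      mid : NeverMiddle D x y z
      mid w m with ≺-connex (dom w m) (x≢y r) | ≺-connex (dom w m) (x≢z r)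
      ... | inj₁ p | inj₁ q = inj₁ (p , q)
      ... | inj₂ p | inj₂ q = inj₂ (p , q)
      ... | inj₁ p | inj₂ q = ⊥-elim (never w m (at-middle (dom w m) (arr-swapʳ r) q p))
      ... | inj₂ p | inj₁ q = ⊥-elim (never w m (at-middle (dom w m) r p q))

  peakPit⇒ : IsPeakPitCondorcet D → ∀ {a b c} → Distinct3 a b c → PeakPit D a b c
  peakPit⇒ C d with C _ _ _ d
  ... | x , k , x∈ , tb , never with arr-focus d x∈
  ...   | y , z , r = go k tb never
    where
    go : ∀ k → TopOrBottom k → Never D _ _ _ x k → _
    go zero _ never = x , y , z , r , inj₁ λ w m t → never w m (at-top (dom w m) r t)
    go (suc zero) (inj₁ ())
    go (suc zero) (inj₂ ())
    go (suc (suc zero)) _ never = x , y , z , r , inj₂ λ w m t → never w m (at-bottom (dom w m) r t)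

  ⇒peakPit : (∀ {a b c} → Distinct3 a b c → PeakPit D a b c) → IsPeakPitCondorcet D
  ⇒peakPit P a b c d with P d
  ... | x , y , z , r , inj₁ never =
    x , zero , ⊆abc r (inj₁ refl) , inj₁ refl , λ w m e → never w m (top-at (dom w m) r e)
  ... | x , y , z , r , inj₂ never =
    x , suc (suc zero) , ⊆abc r (inj₁ refl) , inj₂ refl , λ w m e → never w m (bottom-at (dom w m) r e)

-- Applied to a never-middle triple, this finds either one end common to all members or a member
-- with the other end.
split : {P Q : A → Set} (xs : List A) → (∀ x → x ∈ xs → P x ⊎ Q x) →
  (∀ x → x ∈ xs → P x) ⊎ (∃[ x ] (x ∈ xs × Q x))
split [] _ = inj₁ λ _ ()
split (x ∷ xs) f with f x (here refl) | split xs (λ y m → f y (there m))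
... | inj₂ q | _                  = inj₂ (x , here refl , q)
... | inj₁ _ | inj₂ (y , m , q)   = inj₂ (y , there m , q)
... | inj₁ p | inj₁ ps            = inj₁ λ where
  _ (here refl) → p
  y (there m)   → ps y m

-- Betweenness and inversion counts.

_⊑_ : List A → List A → Set
v ⊑ w = ∀ {x y} → x ≺[ v ] y → x ≺[ w ] y

-- Betweenness for the inversion distance: on linear orders, `t` may depart from `r` only where `s`
-- does.
Between : List A → List A → List A → Set
Between r t s = ∀ {x y} → x ≺[ r ] y → x ≺[ s ] y → x ≺[ t ] y

-- The Kendall tau distance. Each disagreement is counted once, through the ordered pair as `r` has
-- it.
inversions : ∀ {r s} → IsLinearOrder {n} r → IsLinearOrder s → ℕ
inversions {n} r s = length (filter (λ (x , y) → ≺-dec r x y ×-dec ≺-dec s y x)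
  (cartesianProduct (allFin n) (allFin n)))

inversions-< : ∀ {r s r′ s′} (r-lin : IsLinearOrder {n} r) (s-lin : IsLinearOrder s)
  (r′-lin : IsLinearOrder r′) (s′-lin : IsLinearOrder s′) →
  (∀ {x y} → x ≺[ r ] y → y ≺[ s ] x → x ≺[ r′ ] y × y ≺[ s′ ] x) →
  ∀ {x y} → x ≺[ r′ ] y → y ≺[ s′ ] x → ¬ (x ≺[ r ] y × y ≺[ s ] x) →
  inversions r-lin s-lin ℕ.< inversions r′-lin s′-lin
inversions-< r-lin s-lin r′-lin s′-lin sub {x} {y} p q ¬pq =
  length-filter-⊂ _ _ (λ (p , q) → sub p q) _
    (∈-cartesianProduct⁺ (∈-allFin x) (∈-allFin y)) (p , q) ¬pq

-- Closure of a maximal peak-pit domain under medians.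

module MaximalPeakPit {n : ℕ} {D : Domain n} (dom : IsDomain D)
  (peakPit : ∀ {a b c} → Distinct3 a b c → PeakPit D a b c)
  -- Stated for one added word, since medians, swaps and the words of a larger domain are all added
  -- one at a time.
  (maximal : ∀ {w} → IsLinearOrder w →
    (∀ {a b c} → Distinct3 a b c → PeakPit (w ∷ D) a b c) → w ∈ D)
  where

  uniq : ∀ {w} → w ∈ D → Unique w
  uniq m = proj₁ (dom _ m)

  module Median {r s t : List (Fin n)} (r∈ : r ∈ D) (s∈ : s ∈ D) (t∈ : t ∈ D) where
    Majority : (List (Fin n) → Set) → Set
    Majority P = P r × P s ⊎ P r × P t ⊎ P s × P t

    -- Two majorities among three voters share a voter, who witnesses both properties at once.
    majority-∩ : ∀ {P Q} → Majority P → Majority Q → ∃[ w ] (w ∈ D × P w × Q w)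
    majority-∩ (inj₁ (p , _))        (inj₁ (q , _))        = r , r∈ , p , q
    majority-∩ (inj₁ (p , _))        (inj₂ (inj₁ (q , _))) = r , r∈ , p , q
    majority-∩ (inj₁ (_ , p))        (inj₂ (inj₂ (q , _))) = s , s∈ , p , q
    majority-∩ (inj₂ (inj₁ (p , _))) (inj₁ (q , _))        = r , r∈ , p , q
    majority-∩ (inj₂ (inj₁ (p , _))) (inj₂ (inj₁ (q , _))) = r , r∈ , p , q
    majority-∩ (inj₂ (inj₁ (_ , p))) (inj₂ (inj₂ (_ , q))) = t , t∈ , p , q
    majority-∩ (inj₂ (inj₂ (p , _))) (inj₁ (_ , q))        = s , s∈ , p , q
    majority-∩ (inj₂ (inj₂ (_ , p))) (inj₂ (inj₁ (_ , q))) = t , t∈ , p , q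
    majority-∩ (inj₂ (inj₂ (p , _))) (inj₂ (inj₂ (q , _))) = s , s∈ , p , q

    _≺ₘ_ : Fin n → Fin n → Set
    x ≺ₘ y = Majority (λ w → x ≺[ w ] y)

    ≺ₘ-dec : ∀ x y → Dec (x ≺ₘ y)
    ≺ₘ-dec x y = (r? ×-dec s?) ⊎-dec ((r? ×-dec t?) ⊎-dec (s? ×-dec t?))
      where
      r? = ≺-dec (dom _ r∈) x y
      s? = ≺-dec (dom _ s∈) x y
      t? = ≺-dec (dom _ t∈) x y

    ≺ₘ-asym : ∀ {x y} → x ≺ₘ y → ¬ y ≺ₘ x
    ≺ₘ-asym p q with majority-∩ p q
    ... | _ , m , p′ , q′ = ≺-asym (uniq m) p′ q′

    ≺ₘ-connex : ∀ {x y} → x ≢ y → x ≺ₘ y ⊎ y ≺ₘ x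
    ≺ₘ-connex x≢y with ≺-connex (dom _ r∈) x≢y | ≺-connex (dom _ s∈) x≢y | ≺-connex (dom _ t∈) x≢y
    ... | inj₁ p | inj₁ q | _      = inj₁ (inj₁ (p , q))
    ... | inj₁ p | inj₂ _ | inj₁ q = inj₁ (inj₂ (inj₁ (p , q)))
    ... | inj₂ _ | inj₁ p | inj₁ q = inj₁ (inj₂ (inj₂ (p , q)))
    ... | inj₂ p | inj₂ q | _      = inj₂ (inj₁ (p , q))
    ... | inj₂ p | inj₁ _ | inj₂ q = inj₂ (inj₂ (inj₁ (p , q)))
    ... | inj₁ _ | inj₂ p | inj₂ q = inj₂ (inj₂ (inj₂ (p , q)))

    -- A majority cycle would put each of the three alternatives on top, and each at the
    -- bottom, in some member of D.
    ≺ₘ-acyclic : ∀ {x y z} → Distinct3 x y z → x ≺ₘ y → y ≺ₘ z → ¬ z ≺ₘ x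
    ≺ₘ-acyclic {x} {y} {z} d xy yz zx with peakPit d
    ... | u , v , v′ , a , inj₁ never =
      let w , m , top = onTop (⊆abc a (inj₁ refl)) in
      never w m ( top (⊆abc a (inj₂ (inj₁ refl))) (x≢y a)
                , top (⊆abc a (inj₂ (inj₂ refl))) (x≢z a))
      where
      first : ∀ {x y z} → x ≺ₘ y → y ≺ₘ z →
        ∃[ w ] (w ∈ D × (∀ {v} → In3 v x y z → x ≢ v → x ≺[ w ] v))
      first p q with majority-∩ p q
      ... | w , m , p , q = w , m , λ where
        (inj₁ refl)        x≢x → ⊥-elim (x≢x refl)
        (inj₂ (inj₁ refl)) _   → p
        (inj₂ (inj₂ refl)) _   → ≺-trans (uniq m) p q

      onTop : ∀ {u} → In3 u x y z → ∃[ w ] (w ∈ D × (∀ {v} → In3 v x y z → u ≢ v → u ≺[ w ] v))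
      onTop (inj₁ refl) = first xy yz
      onTop (inj₂ (inj₁ refl)) with first yz zx
      ... | w , m , f = w , m , f ∘ In3-rotate
      onTop (inj₂ (inj₂ refl)) with first zx xy
      ... | w , m , f = w , m , f ∘ In3-rotate ∘ In3-rotate
    ... | u , v , v′ , a , inj₂ never =
      let w , m , bot = atBottom (⊆abc a (inj₁ refl)) in
      never w m ( bot (⊆abc a (inj₂ (inj₁ refl))) (x≢y a)
                , bot (⊆abc a (inj₂ (inj₂ refl))) (x≢z a))
      where
      last : ∀ {x y z} → y ≺ₘ z → z ≺ₘ x →
        ∃[ w ] (w ∈ D × (∀ {v} → In3 v x y z → x ≢ v → v ≺[ w ] x))
      last p q with majority-∩ p q
      ... | w , m , p , q = w , m , λ where
        (inj₁ refl)        x≢x → ⊥-elim (x≢x refl)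
        (inj₂ (inj₁ refl)) _   → ≺-trans (uniq m) p q
        (inj₂ (inj₂ refl)) _   → q

      atBottom : ∀ {u} → In3 u x y z →
        ∃[ w ] (w ∈ D × (∀ {v} → In3 v x y z → u ≢ v → v ≺[ w ] u))
      atBottom (inj₁ refl) = last yz zx
      atBottom (inj₂ (inj₁ refl)) with last zx xy
      ... | w , m , f = w , m , f ∘ In3-rotate
      atBottom (inj₂ (inj₂ refl)) with last xy yz
      ... | w , m , f = w , m , f ∘ In3-rotate ∘ In3-rotate

    ≺ₘ-≢ : ∀ {x y} → x ≺ₘ y → x ≢ y
    ≺ₘ-≢ p refl = ≺ₘ-asym p p

    -- By connexity a failure would close a majority cycle, of length two if `x` equals `z` and of
    -- length three otherwise.
    ≺ₘ-trans : ∀ {x y z} → x ≺ₘ y → y ≺ₘ z → x ≺ₘ z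
    ≺ₘ-trans {x} {y} {z} p q with x ≟ z
    ... | yes refl = ⊥-elim (≺ₘ-asym p q)
    ... | no x≢z with ≺ₘ-connex x≢z
    ...   | inj₁ xz = xz
    ...   | inj₂ zx = ⊥-elim (≺ₘ-acyclic (≺ₘ-≢ p , x≢z , ≺ₘ-≢ q) p q zx)

    -- A violation of never-top or never-bottom consists of two comparisons. If each has a majority,
    -- a common voter already violates the condition in `D`; so the median keeps every such
    -- condition and maximality admits it.
    median : ∃[ m ] (m ∈ D × (∀ {x y} → x ≺[ m ] y → x ≺ₘ y))
    median with linearise ≺ₘ-dec ≺ₘ-connex ≺ₘ-asym ≺ₘ-trans
    ... | m , lin , m⊆ = m , maximal lin extend , m⊆
      where
      extend : ∀ {a b c} → Distinct3 a b c → PeakPit (m ∷ D) a b c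
      extend d with peakPit d
      ... | x , y , z , a , inj₁ never = x , y , z , a , inj₁ λ where
        w (there i) t → never w i t
        w (here refl) (p , q) → let v , i , t = majority-∩ (m⊆ p) (m⊆ q) in never v i t
      ... | x , y , z , a , inj₂ never = x , y , z , a , inj₂ λ where
        w (there i) t → never w i t
        w (here refl) (p , q) → let v , i , t = majority-∩ (m⊆ p) (m⊆ q) in never v i t

  -- Neighbouring members and swaps between them.

  -- Between linear orders `⊑` already means equality of orders, so no member lies strictly between
  -- `r` and `s`.
  Neighbours : List (Fin n) → List (Fin n) → Set
  Neighbours r s = ∀ {t} → t ∈ D → Between r t s → r ⊑ t ⊎ s ⊑ t

  -- The median of `r`, `s`, `t` lies between `r` and `s`, hence agrees with one of them. Where `r`
  -- and `s` disagree, `t` casts the deciding vote, so there `t` agrees with the median.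
  neighbours-split : ∀ {r s} → r ∈ D → s ∈ D → Neighbours r s → ∀ {t} → t ∈ D →
    (∀ {x y} → x ≺[ r ] y → y ≺[ s ] x → x ≺[ t ] y)
    ⊎ (∀ {x y} → x ≺[ r ] y → y ≺[ s ] x → y ≺[ t ] x)
  neighbours-split r∈ s∈ nb t∈ with Median.median r∈ s∈ t∈
  ... | m , m∈ , m⊆ = ⊎-map
    (λ r⊑m p q → case m⊆ (r⊑m p) of λ where
      (inj₁ (_ , q′))        → ⊥-elim (≺-asym (uniq s∈) q q′)
      (inj₂ (inj₁ (_ , p′))) → p′
      (inj₂ (inj₂ (_ , p′))) → p′)
    (λ s⊑m p q → case m⊆ (s⊑m q) of λ where
      (inj₁ (p′ , _))        → ⊥-elim (≺-asym (uniq r∈) p p′)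
      (inj₂ (inj₁ (_ , q′))) → q′
      (inj₂ (inj₂ (_ , q′))) → q′)
    (nb m∈ between)
    where
    open Median r∈ s∈ t∈ using (≺ₘ-asym)
    between : Between _ m _
    between p q with ≺-connex (dom _ m∈) (≺-≢ (uniq r∈) p)
    ... | inj₁ xy = xy
    ... | inj₂ yx = ⊥-elim (≺ₘ-asym (m⊆ yx) (inj₁ (p , q)))

  swap-linear : ∀ xs {p q : Fin n} {ys} → (xs ++ p ∷ q ∷ ys) ∈ D → IsLinearOrder (xs ++ q ∷ p ∷ ys)
  swap-linear xs r∈ = linear-resp-↭ (++⁺ˡ xs (↭-swap _ _ ↭-refl)) (dom _ r∈)

  -- If the swap breaks "q never on top" of {p, q, z}, then r and s restrict to pqz and zqp;
  -- being neighbours they force every member of D to do the same, so that q is never at the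
  -- bottom. The other case is dual.
  swap-∈ : ∀ xs {p q ys s} → (xs ++ p ∷ q ∷ ys) ∈ D → s ∈ D → Neighbours (xs ++ p ∷ q ∷ ys) s →
    q ≺[ s ] p → (xs ++ q ∷ p ∷ ys) ∈ D
  swap-∈ xs {p} {q} {ys} {s} r∈ s∈ nb q≺p = maximal lin′ extend
    where
    r  = xs ++ p ∷ q ∷ ys
    r′ = xs ++ q ∷ p ∷ ys

    lin′ : IsLinearOrder r′
    lin′ = swap-linear xs r∈

    u′ = proj₁ lin′

    module _ {a b c : Fin n} where
      brokenTop : ∀ {z} → Arrangement a b c q p z → NeverTop D q p z → q ≺[ r′ ] z →
        PeakPit (r′ ∷ D) a b c
      brokenTop {z} arr never q≺′z = q , p , z , arr , inj₂ λ where
          w (here refl) (p≺q , _)   → ≺-asym u′ p≺q (swapped-≺ xs)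
          w (there w∈) (p≺q , z≺q) → [ (λ like-r → ≺-asym (uniq w∈) z≺q (like-r q≺z z≺ₛq))
                                     , (λ like-s → ≺-asym (uniq w∈) p≺q (like-s (swapped-≺ xs) q≺p))
                                     ]′ (neighbours-split r∈ s∈ nb w∈)
        where
        q≺z : q ≺[ r ] z
        q≺z = [ (λ e → e) , (λ (_ , z≡p) → ⊥-elim (y≢z arr (sym z≡p))) ]′ (swap-≺ xs q≺′z)
        z≺ₛq : z ≺[ s ] q
        z≺ₛq = [ (λ q≺ₛz → ⊥-elim (never s s∈ (q≺p , q≺ₛz))) , (λ e → e) ]′
          (≺-connex (dom _ s∈) (x≢z arr))

      brokenBottom : ∀ {z} → Arrangement a b c p q z → NeverBottom D p q z → z ≺[ r′ ] p →
        PeakPit (r′ ∷ D) a b c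
      brokenBottom {z} arr never z≺′p = p , q , z , arr , inj₁ λ where
          w (here refl) (p≺q , _)   → ≺-asym u′ p≺q (swapped-≺ xs)
          w (there w∈) (p≺q , p≺z) → [ (λ like-r → ≺-asym (uniq w∈) p≺z (like-r z≺p p≺ₛz))
                                     , (λ like-s → ≺-asym (uniq w∈) p≺q (like-s (swapped-≺ xs) q≺p))
                                     ]′ (neighbours-split r∈ s∈ nb w∈)
        where
        z≺p : z ≺[ r ] p
        z≺p = [ (λ e → e) , (λ (z≡q , _) → ⊥-elim (y≢z arr (sym z≡q))) ]′ (swap-≺ xs z≺′p)
        p≺ₛz : p ≺[ s ] z
        p≺ₛz = [ (λ e → e) , (λ z≺ₛp → ⊥-elim (never s s∈ (q≺p , z≺ₛp))) ]′
          (≺-connex (dom _ s∈) (x≢z arr))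

    extend : ∀ {a b c} → Distinct3 a b c → PeakPit (r′ ∷ D) a b c
    extend d with peakPit d
    ... | x , y , z , arr , inj₁ never with ≺-dec lin′ x y ×-dec ≺-dec lin′ x z
    ...   | no ¬top = x , y , z , arr , inj₁ λ where
      w (here refl) t → ¬top t
      w (there w∈) t  → never w w∈ t
    -- A violation by the swapped word must use the swapped pair; otherwise both comparisons hold in
    -- `r`, which would violate the condition itself.
    ...   | yes (xy , xz) with swap-≺ xs xy | swap-≺ xs xz
    ...     | inj₂ (refl , refl) | _ = brokenTop arr never xz
    ...     | inj₁ _ | inj₂ (refl , refl) =
      brokenTop (arr-swapʳ arr) (λ w w∈ (s , t) → never w w∈ (t , s)) xy
    ...     | inj₁ xy′ | inj₁ xz′ = ⊥-elim (never r r∈ (xy′ , xz′))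
    extend d | x , y , z , arr , inj₂ never with ≺-dec lin′ y x ×-dec ≺-dec lin′ z x
    ...   | no ¬bot = x , y , z , arr , inj₂ λ where
      w (here refl) t → ¬bot t
      w (there w∈) t  → never w w∈ t
    ...   | yes (yx , zx) with swap-≺ xs yx | swap-≺ xs zx
    ...     | inj₂ (refl , refl) | _ = brokenBottom arr never zx
    ...     | inj₁ _ | inj₂ (refl , refl) =
      brokenBottom (arr-swapʳ arr) (λ w w∈ (s , t) → never w w∈ (t , s)) yx
    ...     | inj₁ yx′ | inj₁ zx′ = ⊥-elim (never r r∈ (yx′ , zx′))

  -- Never-middle triples have a single end.

  module _ {b a c : Fin n} (a≢c : a ≢ c) (mid : NeverMiddle D b a c) where
    -- Well-founded recursion on the inversion count stands in for the choice of a closest pair.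
    top-bottom-exclusive : ∀ {r s} → r ∈ D → s ∈ D → Top r b a c → ¬ Bottom s b a c
    top-bottom-exclusive r∈ s∈ = go r∈ s∈ (<-wellFounded _)
      where
      go : ∀ {r s} (r∈ : r ∈ D) (s∈ : s ∈ D) → Acc ℕ._<_ (inversions (dom r r∈) (dom s s∈)) →
        Top r b a c → ¬ Bottom s b a c
      go {r} {s} r∈ s∈ (acc rec) top bot = contra (adjacent-inversion (dom s s∈) r (uniq r∈))
        where
        -- A member between the two has `b` at one end, so it can replace `r` or `s`. `Between` lets
        -- no new inversion arise, and an adjacent pair of the replaced word that is inverted in `t`
        -- removes one, so recursion refutes the closer pair. Hence `t` agrees with the word it
        -- would replace.
        nb : Neighbours r s
        nb {t} t∈ between with mid t t∈
        ... | inj₁ top′ = inj₁ (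
          [ (λ { (xs , p , q , ys , refl , q≺p) → ⊥-elim (go t∈ s∈
                 (rec (inversions-< (dom t t∈) (dom s s∈) (dom r r∈) (dom s s∈)
                   (λ xy yx → [ (λ e → e) , (λ yx′ → ⊥-elim (≺-asym (uniq t∈) xy (between yx′ yx))) ]′
                                (≺-connex (dom r r∈) (≺-≢ (uniq t∈) xy)) , yx)
                   (swapped-≺ xs)
                   ([ (λ pq → ⊥-elim (≺-asym (uniq t∈) q≺p (between (swapped-≺ xs) pq))) , (λ e → e) ]′
                     (≺-connex (dom s s∈) (≺-≢ (uniq r∈) (swapped-≺ xs))))
                   (λ (pq , _) → ≺-asym (uniq t∈) q≺p pq)))
                 top′ bot) })
          , (λ e → e) ]′ (adjacent-inversion (dom t t∈) r (uniq r∈)))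
        ... | inj₂ bot′ = inj₂ (
          [ (λ { (xs , p , q , ys , refl , q≺p) → ⊥-elim (go r∈ t∈
                 (rec (inversions-< (dom r r∈) (dom t t∈) (dom r r∈) (dom s s∈)
                   (λ xy yx → xy , [ (λ e → e) , (λ xy′ → ⊥-elim (≺-asym (uniq t∈) yx (between xy xy′))) ]′
                                (≺-connex (dom s s∈) (≺-≢ (uniq t∈) yx)))
                   ([ (λ pq → ⊥-elim (≺-asym (uniq t∈) q≺p (between pq (swapped-≺ xs)))) , (λ e → e) ]′
                     (≺-connex (dom r r∈) (≺-≢ (uniq s∈) (swapped-≺ xs))))
                   (swapped-≺ xs)
                   (λ (_ , pq) → ≺-asym (uniq t∈) q≺p pq)))
                 top bot′) })
          , (λ e → e) ]′ (adjacent-inversion (dom t t∈) s (uniq s∈)))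

        contra : ¬ _
        contra (inj₂ r⊑s) = ≺-asym (uniq s∈) (r⊑s (proj₁ top)) (proj₁ bot)
        -- The swapped word departs from `r` only on a pair that `s` inverts, so it lies between
        -- them and must agree with one of them.
        contra (inj₁ (xs , p , q , ys , refl , q≺p)) with swap-∈ xs r∈ s∈ nb q≺p
        ... | r′∈ with nb r′∈ between
          where
          between : Between (xs ++ p ∷ q ∷ ys) (xs ++ q ∷ p ∷ ys) s
          between xy xy′ with ≺-connex (dom _ r′∈) (≺-≢ (uniq r∈) xy)
          ... | inj₁ e = e
          ... | inj₂ yx with swap-≺ xs yx
          ...   | inj₁ yx′           = ⊥-elim (≺-asym (uniq r∈) xy yx′)
          ...   | inj₂ (refl , refl) = ⊥-elim (≺-asym (uniq s∈) xy′ q≺p)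
        ...   | inj₁ r⊑r′ = ≺-asym (uniq r′∈) (r⊑r′ (swapped-≺ xs)) (swapped-≺ xs)
        -- Agreement with `s` would reverse both comparisons of `b`, with `a` and with `c`, whereas
        -- a swap reverses just one.
        ...   | inj₂ s⊑r′ with swap-≺ xs (s⊑r′ (proj₁ bot)) | swap-≺ xs (s⊑r′ (proj₂ bot))
        ...     | inj₁ ab        | _              = ≺-asym (uniq r∈) (proj₁ top) ab
        ...     | inj₂ _         | inj₁ cb        = ≺-asym (uniq r∈) (proj₂ top) cb
        ...     | inj₂ (a≡q , _) | inj₂ (c≡q , _) = a≢c (trans a≡q (sym c≡q))

  -- Condorcet extensions of a maximal peak-pit domain.

  condorcet-⊆ : ∀ {D′} → IsDomain D′ → IsCondorcet D′ → D ⊆D D′ → D′ ⊆D D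
  condorcet-⊆ {D′} dom′ C D⊆D′ w w∈′ = maximal (dom′ w w∈′) extend
    where
    uniq′ : ∀ {v} → v ∈ D′ → Unique v
    uniq′ m = proj₁ (dom′ _ m)

    w∷D⊆ : ∀ v → v ∈ w ∷ D → v ∈ D′
    w∷D⊆ v (here refl) = w∈′
    w∷D⊆ v (there m)   = D⊆D′ v m

    extend : ∀ {a b c} → Distinct3 a b c → PeakPit (w ∷ D) a b c
    extend d with condorcet⇒ dom′ C d
    ... | inj₁ (x , y , z , arr , inj₁ never) = x , y , z , arr , inj₁ λ v m → never v (w∷D⊆ v m)
    ... | inj₁ (x , y , z , arr , inj₂ never) = x , y , z , arr , inj₂ λ v m → never v (w∷D⊆ v m)
    -- Never-top and never-bottom conditions pass down from `D′`; a never-middle condition has to be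
    -- replaced by one of these.
    ... | inj₂ (b , a , c , arr , mid) with split D (λ v m → mid v (D⊆D′ v m))
    ...   | inj₁ tops with mid w w∈′
    ...     | inj₁ (ba , _) = b , a , c , arr , inj₂ λ where
      v (here refl) (ab , _) → ≺-asym (uniq′ w∈′) ab ba
      v (there m)   (ab , _) → ≺-asym (uniq m) ab (proj₁ (tops v m))
    -- With `b` on top throughout `D` but at the bottom of `w`, the lower of `a` and `c` in `w` is
    -- never on top.
    ...     | inj₂ _ with ≺-connex (dom′ w w∈′) (y≢z arr)
    ...       | inj₁ ac = c , b , a , arr-rotate (arr-rotate arr) , inj₁ λ where
      v (here refl) (_ , ca) → ≺-asym (uniq′ w∈′) ac ca
      v (there m)   (cb , _) → ≺-asym (uniq m) cb (proj₂ (tops v m))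
    ...       | inj₂ ca = a , b , c , arr-swap arr , inj₁ λ where
      v (here refl) (_ , ac) → ≺-asym (uniq′ w∈′) ac ca
      v (there m)   (ab , _) → ≺-asym (uniq m) ab (proj₁ (tops v m))
    extend d | inj₂ (b , a , c , arr , mid) | inj₂ (s , s∈ , bot)
      with split D (λ v m → ⊎-swap (mid v (D⊆D′ v m)))
    ...   | inj₂ (r , r∈ , top) =
      ⊥-elim (top-bottom-exclusive (y≢z arr) (λ v m → mid v (D⊆D′ v m)) r∈ s∈ top bot)
    ...   | inj₁ bots with mid w w∈′
    ...     | inj₂ (ab , _) = b , a , c , arr , inj₁ λ where
      v (here refl) (ba , _) → ≺-asym (uniq′ w∈′) ab ba
      v (there m)   (ba , _) → ≺-asym (uniq m) ba (proj₁ (bots v m))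
    -- Dually, the upper of `a` and `c` in `w` is never at the bottom.
    ...     | inj₁ _ with ≺-connex (dom′ w w∈′) (y≢z arr)
    ...       | inj₁ ac = a , b , c , arr-swap arr , inj₂ λ where
      v (here refl) (_ , ca) → ≺-asym (uniq′ w∈′) ac ca
      v (there m)   (ba , _) → ≺-asym (uniq m) ba (proj₁ (bots v m))
    ...       | inj₂ ca = c , b , a , arr-rotate (arr-rotate arr) , inj₂ λ where
      v (here refl) (_ , ac) → ≺-asym (uniq′ w∈′) ac ca
      v (there m)   (bc , _) → ≺-asym (uniq m) bc (proj₂ (bots v m))

-- The equivalence of the two notions of maximality.

peakPit⇒condorcet : {D : Domain n} → IsPeakPitCondorcet D → IsCondorcet D
peakPit⇒condorcet C a b c d with C a b c d
... | x , k , x∈ , _ , never = x , k , x∈ , never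

theorem2 : (n : ℕ) (D : Domain n) → IsDomain D → IsCondorcet D →
    IsPeakPitMaximalCD D ⇔ IsMaximalPeakPitCD D
theorem2 n D dom _ = mk⇔
  -- Peak-pit extensions are among the Condorcet extensions.
  (λ (dom , C , max) → dom , C , λ D′ dom′ C′ → max D′ dom′ (peakPit⇒condorcet C′))
  (λ (dom , C , max) → dom , C , λ D′ dom′ C′ →
    MaximalPeakPit.condorcet-⊆ dom (peakPit⇒ dom C)
      -- One-word maximality is maximality against `w ∷ D`, read at its head.
      (λ {w} lin P →
        let dom″ : IsDomain (w ∷ D)
            dom″ = λ where
              v (here refl) → lin
              v (there m)   → dom v m
        in max (w ∷ D) dom″ (⇒peakPit dom″ P) (λ v → there) w (here refl))
      dom′ C′)
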